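{- Let $G$ be a connected graph with $|G|\ge 2$ and let $H$ be an arbitrary graph with $|H|=n$. Then the lexicographic product $G[H]$ is distance preserving if and only if $b\le an+1$ for every pair $a,b\in \mathrm{dp}(G)$ (with $a<b$) bounding a non-dp interval.
   Context: All graphs are finite, undirected and simple, with nonempty vertex set; $|G|$ denotes the number of vertices of $G$. The distance $d_G(u,v)$ is the minimum length (number of edges) of a path from $u$ to $v$ in $G$, and $d_G(u,v)=\infty$ if no such path exists. A subgraph $K$ of $G$ is isometric, written $K\le G$, if $d_K(u,v)=d_G(u,v)$ for every pair of vertices $u,v\in V(K)$. A graph $G$ is distance preserving (dp) if it is connected and has an isometric subgraph with exactly $i$ vertices for every $1\le i\le |G|$. The lexicographic product $G[H]$ is the graph with vertex set $V(G)\times V(H)$ and edge set $E(G[H])=\{(u,x)(v,y) : uv\in E(G),\text{ or } (xy\in E(H)\text{ and }u=v)\}$. $\mathrm{dp}(G)=\{k\ge 1 : G \text{ has an isometric subgraph with } k \text{ vertices}\}$. Two elements $a<b$ of $\mathrm{dp}(G)$ bound a non-dp interval if the set of integers $c$ with $a<c<b$ is nonempty and consists only of elements not in $\mathrm{dp}(G)$. -}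

module Defs where

open import Data.Fin.Base using (Fin)
open import Data.Fin.Properties using (inj⇒≟; *↔×)
open import Data.Fin.Subset using (Subset; Nonempty; ∣_∣) renaming (_∈_ to _∈ₛ_)
open import Data.List.Base using (List; []; _∷_)
open import Data.List.Relation.Unary.Unique.Propositional using (Unique)
open import Data.Nat.Base using (ℕ; zero; suc; _*_; _≤_; _<_; NonZero)
open import Data.Nat.Properties using (m*n≢0)
open import Data.Product.Base using (_×_; _,_; ∃-syntax; Σ-syntax)
open import Data.Product.Function.NonDependent.Propositional using (_×-↔_)
open import Data.Sum.Base using (_⊎_; inj₁; inj₂)
open import Function.Bundles using (_↔_; Inverse)
open import Function.Construct.Composition using (_↔-∘_)
open import Function.Construct.Symmetry using (↔-sym)
open import Function.Properties.Inverse using (↔⇒↣)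
open import Level using (0ℓ)
open import Relation.Binary.Construct.Closure.ReflexiveTransitive using (Star; ε; _◅_)
open import Relation.Binary.Core using (Rel)
open import Relation.Binary.Definitions using (Decidable; DecidableEquality; Irreflexive; Symmetric)
open import Relation.Binary.PropositionalEquality.Core using (_≡_; refl; sym)
open import Relation.Nullary.Construct.Add.Supremum using (_⁺; [_]; ⊤⁺)
open import Relation.Nullary.Decidable using (_×-dec_; _⊎-dec_)
open import Relation.Nullary.Negation using (¬_)

record Graph : Set₁ where
  infix 4 _~_ _~?_
  field
    Vertex   : Set
    order    : ℕ
    nonempty : NonZero order
    index    : Vertex ↔ Fin order
    _~_      : Rel Vertex 0ℓ
    _~?_     : Decidable _~_
    ~-sym    : Symmetric _~_
    ~-irrefl : Irreflexive _≡_ _~_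

  _≟_ : DecidableEquality Vertex
  _≟_ = inj⇒≟ (↔⇒↣ index)

open Graph using (Vertex; order)

-- Walks, paths and distances are defined for an adjacency relation, so that
-- they apply both to a graph and to a subgraph of it. A walk is an element of
-- Star R u v; a path is a walk that repeats no vertex.

module _ {V : Set} {R : Rel V 0ℓ} where

  walkVertices : {u v : V} → Star R u v → List V
  walkVertices {u} ε       = u ∷ []
  walkVertices {u} (_ ◅ w) = u ∷ walkVertices w

  walkLength : {u v : V} → Star R u v → ℕ
  walkLength ε       = zero
  walkLength (_ ◅ w) = suc (walkLength w)

Path : {V : Set} → Rel V 0ℓ → V → V → Set
Path R u v = Σ[ w ∈ Star R u v ] Unique (walkVertices w)

pathLength : {V : Set} {R : Rel V 0ℓ} {u v : V} → Path R u v → ℕ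
pathLength (w , _) = walkLength w

-- IsDistance R u v d says that the distance from u to v is d, with ⊤⁺ for ∞.

IsDistance : {V : Set} → Rel V 0ℓ → V → V → ℕ ⁺ → Set
IsDistance R u v [ d ] =
  (Σ[ p ∈ Path R u v ] pathLength p ≡ d) × ((p : Path R u v) → d ≤ pathLength p)
IsDistance R u v ⊤⁺    = ¬ Path R u v

Connected : Graph → Set
Connected G = (u v : Vertex G) → Path (Graph._~_ G) u v

-- Subgraphs are not assumed induced: the edges are any symmetric set of edges
-- of G whose endpoints are chosen vertices.

record Subgraph (G : Graph) : Set₁ where
  open Graph G using (index; _~_)
  infix 4 _∈V _~ₖ_ _~ₖ?_
  field
    vertices : Subset (order G)

  _∈V : Vertex G → Set
  v ∈V = Inverse.to index v ∈ₛ vertices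

  field
    inhabited : Nonempty vertices
    _~ₖ_      : Rel (Vertex G) 0ℓ
    _~ₖ?_     : Decidable _~ₖ_
    ~ₖ-sym    : Symmetric _~ₖ_
    ~ₖ⇒~      : {u v : Vertex G} → u ~ₖ v → u ~ v
    ~ₖ⇒∈V     : {u v : Vertex G} → u ~ₖ v → u ∈V × v ∈V

  size : ℕ
  size = ∣ vertices ∣

Isometric : {G : Graph} → Subgraph G → Set
Isometric {G} K = (u v : Vertex G) → u ∈V → v ∈V →
  ∃[ d ] (IsDistance _~ₖ_ u v d × IsDistance _~_ u v d)
  where
  open Graph G using (_~_)
  open Subgraph K using (_∈V; _~ₖ_)

HasIsometricSubgraph : Graph → ℕ → Set₁
HasIsometricSubgraph G k = Σ[ K ∈ Subgraph G ] (Isometric K × Subgraph.size K ≡ k)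

DistancePreserving : Graph → Set₁
DistancePreserving G =
  Connected G × ((i : ℕ) → 1 ≤ i → i ≤ order G → HasIsometricSubgraph G i)

infix 4 _∈dp_

_∈dp_ : ℕ → Graph → Set₁
k ∈dp G = 1 ≤ k × HasIsometricSubgraph G k

record BoundsNonDpInterval (G : Graph) (a b : ℕ) : Set₁ where
  field
    a∈dp    : a ∈dp G
    b∈dp    : b ∈dp G
    a<b     : a < b
    between : ∃[ c ] (a < c × c < b)
    gap     : (c : ℕ) → a < c → c < b → ¬ (c ∈dp G)

infix 8 _[_]ₗ

_[_]ₗ : Graph → Graph → Graph
G [ H ]ₗ = record
  { Vertex   = Vertex G × Vertex H
  ; order    = order G * order H
  ; nonempty = m*n≢0 (order G) (order H) {{G.nonempty}} {{H.nonempty}}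
  ; index    = ↔-sym *↔× ↔-∘ (G.index ×-↔ H.index)
  ; _~_      = λ (u , x) (v , y) → u G.~ v ⊎ (x H.~ y × u ≡ v)
  ; _~?_     = λ (u , x) (v , y) → (u G.~? v) ⊎-dec ((x H.~? y) ×-dec (u G.≟ v))
  ; ~-sym    = λ where
      (inj₁ u~v)         → inj₁ (G.~-sym u~v)
      (inj₂ (x~y , u≡v)) → inj₂ (H.~-sym x~y , sym u≡v)
  ; ~-irrefl = λ where
      refl (inj₁ u~u)       → G.~-irrefl refl u~u
      refl (inj₂ (x~x , _)) → H.~-irrefl refl x~x
  }
  where
  module G = Graph G
  module H = Graph H

{-# OPTIONS --safe #-}
module Submission where

-- Dropping edges only lengthens distances, so isometric subgraphs may be taken
-- to be induced and are determined by their vertex sets. Let n = |H|. A walk in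
-- G[H] projects to a walk in G that is no longer, and a walk in G between distinct
-- vertices lifts to G[H] through any choice of intermediate fibre elements. Hence
-- the projection of an isometric set of G[H] is isometric in G, and conversely any
-- set with an isometric projection S, |S| ≥ 2, is isometric: two points of one fibre
-- are joined through a neighbour in S. So dp(G[H]) is the union of the intervals
-- [k, kn] over k in dp(G), the interval for k = 1 being covered by {1} ∪ [2, 2n].
-- This union is [1, |G|n] iff no two consecutive elements a < b of dp(G) with
-- b > a + 1 satisfy an + 1 < b. To pick these elements constructively,
-- membership in dp(G) is decided by searching all vertex sets.

open import Defs
open import Data.Fin.Base using (Fin; zero; suc; combine; fromℕ<)
open import Data.Fin.Properties as Fin using (any?; all?)
open import Data.Fin.Subset using (Subset; Nonempty; inside; outside; ∣_∣; ⊥; ⊤; ⁅_⁆; _∪_) renaming (_∈_ to _∈ₛ_)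
open import Data.Fin.Subset.Properties
  using (nonempty?; anySubset?; _∈?_; ∣p∣≤n; ∣⊥∣≡0; ∉⊥; ∈⊤; ∣⊤∣≡n; x∈⁅x⁆; x∈⁅y⁆⇒x≡y; ∣⁅x⁆∣≡1; Empty-unique;
         p⊆q⇒∣p∣≤∣q∣; p⊂q⇒∣p∣<∣q∣; x∈p⇒∣p-x∣<∣p∣; p⊆p∪q; q⊆p∪q; x∈p∪q⁻)
open import Data.List.Membership.DecPropositional using () renaming (_∈?_ to ∈-dec)
open import Data.List.Membership.Propositional using (_∈_)
open import Data.List.Relation.Unary.All.Properties using (¬Any⇒All¬)
open import Data.List.Relation.Unary.AllPairs using ([]; _∷_)
open import Data.List.Relation.Unary.All using ([])
open import Data.List.Relation.Unary.Any using (here; there)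
open import Data.Maybe.Base using (just; nothing)
open import Data.Nat.Base using (ℕ; zero; suc; _+_; _*_; _∸_; _≤_; _<_; _≥_; z≤n; s≤s; s≤s⁻¹; NonZero; >-nonZero⁻¹)
open import Data.Nat.Properties renaming (_≟_ to _≟ℕ_)
open import Data.Product.Base using (_×_; _,_; ∃-syntax; Σ-syntax; proj₁; proj₂; map₂)
open import Data.Sum.Base using (_⊎_; inj₁; inj₂; [_,_]′)
open import Data.Unit.Base using (tt) renaming (⊤ to Unit)
open import Data.Vec.Base using (Vec; []; _∷_; _++_; concat; map; lookup; group)
open import Data.Vec.Properties using (lookup⇒[]=; []=⇒lookup; lookup-concat; lookup-map)
open import Function.Base using (_∘_)
open import Function.Bundles using (_⇔_; mk⇔; Inverse; Injection; Equivalence)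
open import Function.Properties.Inverse using (↔⇒↣)
open import Level using (Level; 0ℓ)
open import Relation.Binary.Construct.Closure.ReflexiveTransitive using (Star; ε; _◅_)
open import Relation.Binary.Core using (Rel)
open import Relation.Binary.Definitions using (DecidableEquality; tri<; tri≈; tri>) renaming (Decidable to Decidable₂)
open import Relation.Binary.PropositionalEquality.Core using (_≡_; _≢_; refl; sym; trans; cong; cong₂; subst)
open import Relation.Nullary.Construct.Add.Supremum using () renaming ([_] to ⌊_⌋)
open import Relation.Nullary.Decidable using (Dec; yes; no; does; ¬?; map′; _×-dec_; _⊎-dec_; _→-dec_; dec-true; dec-false)
open import Relation.Nullary.Negation using (¬_; contradiction)
open import Relation.Unary using (Pred; Decidable)

private variable
  ℓ   : Level
  m n k d e : ℕ

-- Extremal witnesses of decidable properties of natural numbers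

least : {P : Pred ℕ ℓ} → Decidable P → P m → ∃[ d ] (P d × (∀ {e} → P e → d ≤ e))
least {m = zero}  P? p = zero , p , λ _ → z≤n
least {m = suc m} {P = P} P? p with P? zero
... | yes p₀ = zero , p₀ , λ _ → z≤n
... | no ¬p₀ =
  let d , pd , minimal = least {m = m} {P = P ∘ suc} (P? ∘ suc) p
      minimal⁺ : ∀ {e} → P e → suc d ≤ e
      minimal⁺ = λ { {zero} p₀ → contradiction p₀ ¬p₀ ; {suc e} pe → s≤s (minimal pe) }
  in suc d , pd , minimal⁺

greatestBelow : {P : Pred ℕ ℓ} → Decidable P → P m → m < n →
  ∃[ a ] (m ≤ a × a < n × P a × (∀ {c} → a < c → c < n → ¬ P c))
greatestBelow {n = suc n} {P = P} P? p m≤n with P? n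
... | yes pn = n , s≤s⁻¹ m≤n , ≤-refl , pn , λ n<c c≤n → contradiction (≤-trans n<c (s≤s⁻¹ c≤n)) (n≮n n)
... | no ¬pn =
  let a , m≤a , a<n , pa , maximal =
        greatestBelow P? p (≤∧≢⇒< (s≤s⁻¹ m≤n) λ m≡n → ¬pn (subst P m≡n p))
  in a , m≤a , m≤n⇒m≤1+n a<n , pa , λ a<c c≤n pc →
       maximal a<c (≤∧≢⇒< (s≤s⁻¹ c≤n) λ c≡n → ¬pn (subst P c≡n pc)) pc

-- Bounded walks

-- The index bounds the length from above instead of fixing it, so it survives when a walk is
-- contracted or shortened; the distance is the least inhabited index.
data Within {V : Set} (R : Rel V 0ℓ) : ℕ → Rel V 0ℓ where
  here : ∀ {d u} → Within R d u u
  step : ∀ {d u v w} → R u w → Within R d w v → Within R (suc d) u v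

module _ {V : Set} {R : Rel V 0ℓ} where

  weaken : ∀ {u v} → d ≤ e → Within R d u v → Within R e u v
  weaken d≤e       here       = here
  weaken (s≤s d≤e) (step r w) = step r (weaken d≤e w)

  fromWalk : ∀ {u v} (w : Star R u v) → Within R (walkLength w) u v
  fromWalk ε       = here
  fromWalk (r ◅ w) = step r (fromWalk w)

  first : ∀ {u v} → u ≢ v → Within R d u v → ∃[ w ] R u w
  first u≢v here       = contradiction refl u≢v
  first u≢v (step r _) = _ , r

  module _ (_≟_ : DecidableEquality V) where

    suffix : ∀ {u v w} (p : Path R w v) → u ∈ walkVertices (proj₁ p) →
      Σ[ q ∈ Path R u v ] pathLength q ≤ pathLength p
    suffix p@(ε     , _)      (here refl) = p , ≤-refl
    suffix p@(_ ◅ _ , _)      (here refl) = p , ≤-refl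
    suffix   (_ ◅ w , _ ∷ us) (there u∈w) = map₂ m≤n⇒m≤1+n (suffix (w , us) u∈w)

    toPath : ∀ {u v} → Within R d u v → Σ[ p ∈ Path R u v ] pathLength p ≤ d
    toPath here = (ε , [] ∷ []) , z≤n
    toPath {u = u} (step r w) with toPath w
    ... | p@(ws , us) , p≤d with ∈-dec _≟_ u (walkVertices ws)
    ...   | yes u∈p = map₂ (λ q≤p → m≤n⇒m≤1+n (≤-trans q≤p p≤d)) (suffix p u∈p)
    ...   | no  u∉p = (r ◅ ws , ¬Any⇒All¬ _ u∉p ∷ us) , s≤s p≤d

    -- Every path is a walk, and `toPath` cuts the loops out of a walk without lengthening it, so
    -- the least bound on walks is attained by a path.
    isDistance : ∀ {u v} → Within R d u v → (∀ {e} → Within R e u v → d ≤ e) →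
      IsDistance R u v ⌊ d ⌋
    isDistance w minimal =
      let p , p≤d = toPath w
      in (p , ≤-antisym p≤d (minimal (fromWalk (proj₁ p)))) , λ q → minimal (fromWalk (proj₁ q))

-- An edge contracted by `f` only leaves slack in the bound. This case serves the projection of
-- `G [ H ]ₗ`, where edges inside a fibre collapse.
mapWithin : {U V : Set} {R : Rel U 0ℓ} {Q : Rel V 0ℓ} (f : U → V) →
  (∀ {u v} → R u v → Q (f u) (f v) ⊎ f u ≡ f v) →
  ∀ {u v} → Within R d u v → Within Q d (f u) (f v)
mapWithin f edge here = here
mapWithin {Q = Q} f edge (step {d = d} {v = v} r w) with edge r
... | inj₁ q  = step q (mapWithin f edge w)
... | inj₂ eq = subst (λ u → Within Q (suc d) u (f v)) (sym eq) (weaken (n≤1+n d) (mapWithin f edge w))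

module _ {U X : Set} {R : Rel U 0ℓ} {Q : Rel (U × X) 0ℓ} {F : U → X → Set}
  (edge : ∀ {u v x y} → R u v → F u x → F v y → Q (u , x) (v , y))
  (pick : ∀ {u v} → R u v → ∃[ y ] F v y) where

  -- `F u x` marks the admissible points of the fibre over `u`. Both ends are prescribed, and `pick`
  -- supplies the points between. The empty walk is excluded because it cannot join two different
  -- points of one fibre.
  lift : ∀ {u v x y} → u ≢ v → F u x → F v y → Within R d u v → Within Q d (u , x) (v , y)
  lift u≢v fx fy here       = contradiction refl u≢v
  lift u≢v fx fy (step r w) = go r w fx fy
    where
    -- The edge `r` is held back so that the last edge can land on the prescribed `y`; the walk
    -- after it may be empty.
    go : ∀ {d u v w x y} → R u w → Within R d w v → F u x → F v y → Within Q (suc d) (u , x) (v , y)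
    go r here       fx fy = step (edge r fx fy) here
    go r (step s w) fx fy = let _ , fz = pick r in step (edge r fx fz) (go s w fz fy)

-- Finite sets

Nonempty⇒1≤∣p∣ : {p : Subset n} → Nonempty p → 1 ≤ ∣ p ∣
Nonempty⇒1≤∣p∣ (_ , x∈p) = ≤-trans (s≤s z≤n) (x∈p⇒∣p-x∣<∣p∣ x∈p)

another : {p : Subset n} {i : Fin n} → 2 ≤ ∣ p ∣ → ∃[ j ] (j ∈ₛ p × j ≢ i)
another {p = p} {i} 2≤∣p∣ with any? (λ j → (j ∈? p) ×-dec ¬? (j Fin.≟ i))
... | yes found = found
... | no none = contradiction (≤-trans 2≤∣p∣ (≤-trans (p⊆q⇒∣p∣≤∣q∣ p⊆⁅i⁆) (≤-reflexive (∣⁅x⁆∣≡1 i)))) (n≮n 1)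
  where
  p⊆⁅i⁆ : ∀ {j} → j ∈ₛ p → j ∈ₛ ⁅ i ⁆
  p⊆⁅i⁆ {j} j∈p with j Fin.≟ i
  ... | yes refl = x∈⁅x⁆ i
  ... | no j≢i   = contradiction (j , j∈p , j≢i) none

∣p∪q∣≤∣p∣+∣q∣ : (p q : Subset n) → ∣ p ∪ q ∣ ≤ ∣ p ∣ + ∣ q ∣
∣p∪q∣≤∣p∣+∣q∣ []            []            = z≤n
∣p∪q∣≤∣p∣+∣q∣ (outside ∷ p) (outside ∷ q) = ∣p∪q∣≤∣p∣+∣q∣ p q
∣p∪q∣≤∣p∣+∣q∣ (outside ∷ p) (inside ∷ q)  =
  ≤-trans (s≤s (∣p∪q∣≤∣p∣+∣q∣ p q)) (≤-reflexive (sym (+-suc ∣ p ∣ ∣ q ∣)))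
∣p∪q∣≤∣p∣+∣q∣ (inside ∷ p)  (outside ∷ q) = s≤s (∣p∪q∣≤∣p∣+∣q∣ p q)
∣p∪q∣≤∣p∣+∣q∣ (inside ∷ p)  (inside ∷ q)  =
  s≤s (≤-trans (∣p∪q∣≤∣p∣+∣q∣ p q) (+-monoʳ-≤ ∣ p ∣ (n≤1+n ∣ q ∣)))

∣⁅x⁆∪⁅y⁆∣≡2 : {x y : Fin n} → x ≢ y → ∣ ⁅ x ⁆ ∪ ⁅ y ⁆ ∣ ≡ 2
∣⁅x⁆∪⁅y⁆∣≡2 {x = x} {y} x≢y = ≤-antisym
  (≤-trans (∣p∪q∣≤∣p∣+∣q∣ ⁅ x ⁆ ⁅ y ⁆) (≤-reflexive (cong₂ _+_ (∣⁅x⁆∣≡1 x) (∣⁅x⁆∣≡1 y))))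
  (subst (λ c → suc c ≤ ∣ ⁅ x ⁆ ∪ ⁅ y ⁆ ∣) (∣⁅x⁆∣≡1 x) (p⊂q⇒∣p∣<∣q∣
    (p⊆p∪q ⁅ y ⁆ , y , q⊆p∪q ⁅ x ⁆ ⁅ y ⁆ (x∈⁅x⁆ y) , λ y∈⁅x⁆ → x≢y (sym (x∈⁅y⁆⇒x≡y x y∈⁅x⁆)))))

∣p++q∣≡∣p∣+∣q∣ : (p : Subset m) (q : Subset n) → ∣ p ++ q ∣ ≡ ∣ p ∣ + ∣ q ∣
∣p++q∣≡∣p∣+∣q∣ []            q = refl
∣p++q∣≡∣p∣+∣q∣ (inside ∷ p)  q = cong suc (∣p++q∣≡∣p∣+∣q∣ p q)
∣p++q∣≡∣p∣+∣q∣ (outside ∷ p) q = ∣p++q∣≡∣p∣+∣q∣ p q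

subsetOfSize : k ≤ n → Σ[ p ∈ Subset n ] ∣ p ∣ ≡ k
subsetOfSize {n = n} z≤n = ⊥ , ∣⊥∣≡0 n
subsetOfSize (s≤s k≤n)   = let p , eq = subsetOfSize k≤n in inside ∷ p , cong suc eq

1≤∣p∣⇒Nonempty : (p : Subset n) → 1 ≤ ∣ p ∣ → Nonempty p
1≤∣p∣⇒Nonempty {n = n} p 1≤∣p∣ with nonempty? p
... | yes ne = ne
... | no ¬ne = contradiction (subst (1 ≤_) (trans (cong ∣_∣ (Empty-unique ¬ne)) (∣⊥∣≡0 n)) 1≤∣p∣) (n≮n 0)

-- A subset of Fin (m * n) is handled as the concatenation of its m fibres.

Projection : Subset (m * n) → Subset m → Set
Projection q p = ∀ i → i ∈ₛ p ⇔ (∃[ j ] combine i j ∈ₛ q)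

support : Vec (Subset n) m → Subset m
support = map (does ∘ nonempty?)

support-projection : (ps : Vec (Subset n) m) → Projection (concat ps) (support ps)
support-projection ps i = mk⇔ to from
  where
  lookup-support : lookup (support ps) i ≡ does (nonempty? (lookup ps i))
  lookup-support = lookup-map i (does ∘ nonempty?) ps

  to : i ∈ₛ support ps → ∃[ j ] combine i j ∈ₛ concat ps
  to i∈ with nonempty? (lookup ps i) | trans (sym lookup-support) ([]=⇒lookup i∈)
  ... | yes (j , j∈) | _ = j , lookup⇒[]= _ _ (trans (lookup-concat ps i j) ([]=⇒lookup j∈))

  from : ∃[ j ] combine i j ∈ₛ concat ps → i ∈ₛ support ps
  from (j , ij∈) = lookup⇒[]= _ _ (trans lookup-support (dec-true (nonempty? (lookup ps i))
    (j , lookup⇒[]= _ _ (trans (sym (lookup-concat ps i j)) ([]=⇒lookup ij∈)))))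

∣support∣≤∣concat∣ : (ps : Vec (Subset n) m) → ∣ support ps ∣ ≤ ∣ concat ps ∣
∣support∣≤∣concat∣ []       = z≤n
∣support∣≤∣concat∣ (p ∷ ps) rewrite ∣p++q∣≡∣p∣+∣q∣ p (concat ps) with nonempty? p
... | yes ne = +-mono-≤ (Nonempty⇒1≤∣p∣ ne) (∣support∣≤∣concat∣ ps)
... | no _   = m≤n⇒m≤o+n ∣ p ∣ (∣support∣≤∣concat∣ ps)

∣concat∣≤∣support∣*n : (ps : Vec (Subset n) m) → ∣ concat ps ∣ ≤ ∣ support ps ∣ * n
∣concat∣≤∣support∣*n         []       = z≤n
∣concat∣≤∣support∣*n {n = n} (p ∷ ps) rewrite ∣p++q∣≡∣p∣+∣q∣ p (concat ps) with nonempty? p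
... | yes _  = +-mono-≤ (∣p∣≤n p) (∣concat∣≤∣support∣*n ps)
... | no ¬ne = +-mono-≤ (≤-reflexive (trans (cong ∣_∣ (Empty-unique ¬ne)) (∣⊥∣≡0 n))) (∣concat∣≤∣support∣*n ps)

-- Each nonempty fibre contributes at least one and at most `n` elements, whence both size bounds.
project : ∀ m n (q : Subset (m * n)) →
  Σ[ p ∈ Subset m ] (Projection q p × ∣ p ∣ ≤ ∣ q ∣ × ∣ q ∣ ≤ ∣ p ∣ * n)
project m n q with group m n q
... | ps , refl = support ps , support-projection ps , ∣support∣≤∣concat∣ ps , ∣concat∣≤∣support∣*n ps

-- c elements go to the fibre over one point, and d to the fibres over k others.
split : .{{NonZero n}} → suc k ≤ e → e ≤ n + k * n →
  ∃[ c ] ∃[ d ] (1 ≤ c × c ≤ n × k ≤ d × d ≤ k * n × c + d ≡ e)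
split {n = n} {k} {e} k<e e≤n+kn with ≤-total (n + k) e
-- The `k` other fibres need one element each. If filling the first fibre leaves enough for that, it
-- is filled; otherwise the others get exactly one each and the first takes the rest, which is
-- positive because `k < e`.
... | inj₁ n+k≤e = n , e ∸ n , >-nonZero⁻¹ n , ≤-refl , m+n≤o⇒m≤o∸n k (subst (_≤ e) (+-comm n k) n+k≤e) ,
                   m≤n+o⇒m∸n≤o e n e≤n+kn ,
                   m+[n∸m]≡n (≤-trans (m≤m+n n k) n+k≤e)
... | inj₂ e≤n+k = e ∸ k , k , m<n⇒0<n∸m k<e , m≤n+o⇒m∸n≤o e k (subst (e ≤_) (+-comm n k) e≤n+k) , ≤-refl ,
                   m≤m*n k n , m∸n+n≡m (<⇒≤ k<e)

-- By induction on `p`: `split` serves the first chosen fibre in such a way that both size bounds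
-- persist for the remaining ones.
fibres : .{{_ : NonZero n}} (p : Subset m) → ∣ p ∣ ≤ e → e ≤ ∣ p ∣ * n →
  Σ[ ps ∈ Vec (Subset n) m ] (support ps ≡ p × ∣ concat ps ∣ ≡ e)
fibres [] _ z≤n = [] , refl , refl
fibres {n = n} (outside ∷ p) lower upper =
  let ps , sup , size = fibres p lower upper
  in ⊥ ∷ ps , cong₂ _∷_ (dec-false (nonempty? {n} ⊥) (λ (_ , i∈⊥) → ∉⊥ i∈⊥)) sup ,
     trans (∣p++q∣≡∣p∣+∣q∣ (⊥ {n}) (concat ps)) (cong₂ _+_ (∣⊥∣≡0 n) size)
fibres (inside ∷ p) lower upper =
  let c , d , 1≤c , c≤n , lower′ , upper′ , c+d≡e = split {k = ∣ p ∣} lower upper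
      q , ∣q∣≡c = subsetOfSize c≤n
      ps , sup , size = fibres p lower′ upper′
  in q ∷ ps ,
     cong₂ _∷_ (dec-true (nonempty? q) (1≤∣p∣⇒Nonempty q (subst (1 ≤_) (sym ∣q∣≡c) 1≤c))) sup ,
     trans (∣p++q∣≡∣p∣+∣q∣ q (concat ps)) (trans (cong₂ _+_ ∣q∣≡c size) c+d≡e)

spread : .{{_ : NonZero n}} (p : Subset m) → ∣ p ∣ ≤ e → e ≤ ∣ p ∣ * n →
  Σ[ q ∈ Subset (m * n) ] (Projection q p × ∣ q ∣ ≡ e)
spread p lower upper with fibres p lower upper
... | ps , refl , size = concat ps , support-projection ps , size

-- Isometric vertex sets

module _ (G : Graph) where
  open Graph G

  enum : Fin order → Vertex
  enum = Inverse.from index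

  # : Vertex → Fin order
  # = Inverse.to index

  enum-# : ∀ v → enum (# v) ≡ v
  enum-# = Inverse.strictlyInverseʳ index

  #-enum : ∀ i → # (enum i) ≡ i
  #-enum = Inverse.strictlyInverseˡ index

  #-injective : ∀ {u v} → # u ≡ # v → u ≡ v
  #-injective = Injection.injective (↔⇒↣ index)

  anyVertex? : {P : Pred Vertex ℓ} → Decidable P → Dec (∃[ v ] P v)
  anyVertex? {P = P} P? = map′ (λ (i , p) → enum i , p)
    (λ (v , p) → # v , subst P (sym (enum-# v)) p) (any? (P? ∘ enum))

  allVertices? : {P : Pred Vertex ℓ} → Decidable P → Dec (∀ v → P v)
  allVertices? {P = P} P? = map′ (λ all v → subst P (enum-# v) (all (# v)))
    (λ all i → all (enum i)) (all? (P? ∘ enum))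

  within? : {R : Rel Vertex 0ℓ} → Decidable₂ R → ∀ d → Decidable₂ (Within R d)
  within? {R} R? zero u v = map′ (λ { refl → here }) (λ { here → refl }) (u ≟ v)
  within? {R} R? (suc d) u v = map′
    [ (λ { refl → here }) , (λ (w , r , rest) → step r rest) ]′
    (λ { here → inj₁ refl ; (step r rest) → inj₂ (_ , r , rest) })
    ((u ≟ v) ⊎-dec anyVertex? λ w → R? u w ×-dec within? R? d w v)

  module _ (S : Subset order) where

    Member : Vertex → Set
    Member v = # v ∈ₛ S

    Induced : Rel Vertex 0ℓ
    Induced u v = u ~ v × Member u × Member v

    induced? : Decidable₂ Induced
    induced? u v = (u ~? v) ×-dec ((# u ∈? S) ×-dec (# v ∈? S))

    -- Quantifying over every bound `d` expresses preservation of distances without computing them,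
    -- so walks can be transferred directly.
    IsometricSet : Set
    IsometricSet = ∀ {u v d} → Member u → Member v → Within _~_ d u v → Within Induced d u v

  module _ (conn : Connected G) where

    distance : ∀ u v → ∃[ d ] (Within _~_ d u v × (∀ {e} → Within _~_ e u v → d ≤ e))
    distance u v = least (λ d → within? _~?_ d u v) (fromWalk (proj₁ (conn u v)))

    -- The case where `d` is the distance implies all others by `weaken`, which leaves a finite
    -- check.
    isometricSet? : Decidable IsometricSet
    isometricSet? S = map′
      (λ all {u} {v} u∈S v∈S w →
        weaken (proj₂ (proj₂ (distance u v)) w) (all u v u∈S v∈S))
      (λ iso u v u∈S v∈S → iso u∈S v∈S (proj₁ (proj₂ (distance u v))))
      (allVertices? λ u → allVertices? λ v → (# u ∈? S) →-dec ((# v ∈? S) →-dec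
        within? (induced? S) (proj₁ (distance u v)) u v))

    -- Take the first edge of an induced walk to another member. Such edges give the detours between
    -- points of one fibre.
    neighbour : ∀ {S u} → IsometricSet S → 2 ≤ ∣ S ∣ → Member S u → ∃[ w ] Induced S u w
    neighbour {S} {u} iso 2≤∣S∣ u∈S =
      let j , j∈S , j≢u = another 2≤∣S∣
          u≢j = λ u≡j → j≢u (trans (sym (#-enum j)) (cong # (sym u≡j)))
      in first u≢j (iso u∈S (subst (_∈ₛ S) (sym (#-enum j)) j∈S)
           (fromWalk (proj₁ (conn u (enum j)))))

    fromSet : ∀ {S} → Nonempty S → IsometricSet S → HasIsometricSubgraph G ∣ S ∣
    fromSet {S} ne iso = K , isometric , refl
      where
      K : Subgraph G
      K = record
        { vertices  = S
        ; inhabited = ne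
        ; _~ₖ_      = Induced S
        ; _~ₖ?_     = induced? S
        ; ~ₖ-sym    = λ (u~v , u∈S , v∈S) → ~-sym u~v , v∈S , u∈S
        ; ~ₖ⇒~      = proj₁
        ; ~ₖ⇒∈V     = proj₂
        }

      isometric : Isometric K
      isometric u v u∈S v∈S =
        let d , w , minimal = distance u v
        in ⌊ d ⌋ ,
           isDistance _≟_ (iso u∈S v∈S w) (minimal ∘ mapWithin (λ x → x) (inj₁ ∘ proj₁)) ,
           isDistance _≟_ w minimal

  -- `K` may lack some induced edges, but its shortest paths are induced walks already as short as
  -- any walk in `G`.
  toSet : HasIsometricSubgraph G k → Σ[ S ∈ Subset order ] (Nonempty S × IsometricSet S × ∣ S ∣ ≡ k)
  toSet (K , isometric , size) = vertices , inhabited , iso , size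
    where
    open Subgraph K hiding (size)
    iso : IsometricSet vertices
    iso {u} {v} u∈K v∈K w with isometric u v u∈K v∈K
    -- The walk `w` rules out an infinite distance.
    ... | nothing , _ , none = contradiction (proj₁ (toPath _≟_ w)) none
    ... | just _ , ((p , refl) , _) , _ , minimal =
      let q , q≤d = toPath _≟_ w
      in weaken (≤-trans (minimal q) q≤d)
           (mapWithin (λ x → x) (λ r → inj₁ (~ₖ⇒~ r , ~ₖ⇒∈V r)) (fromWalk (proj₁ p)))

  -- Deciding dp(G), and its elements 1, 2 and |G|

  module _ (conn : Connected G) where

    hasIsometricSubgraph? : ∀ k → Dec (HasIsometricSubgraph G k)
    hasIsometricSubgraph? k = map′ (λ { (_ , ne , iso , refl) → fromSet conn ne iso }) toSet
      (anySubset? λ S → nonempty? S ×-dec (isometricSet? conn S ×-dec (∣ S ∣ ≟ℕ k)))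

    ∈dp? : Decidable (_∈dp G)
    ∈dp? k = (1 ≤? k) ×-dec hasIsometricSubgraph? k

    ⊤-isometric : IsometricSet ⊤
    ⊤-isometric _ _ = mapWithin (λ x → x) (λ r → inj₁ (r , ∈⊤ , ∈⊤))

    1∈dp : 1 ∈dp G
    1∈dp = s≤s z≤n , subst (HasIsometricSubgraph G) (∣⁅x⁆∣≡1 i) (fromSet conn (i , x∈⁅x⁆ i) iso)
      where
      i = fromℕ< (>-nonZero⁻¹ order {{nonempty}})
      iso : IsometricSet ⁅ i ⁆
      iso u∈ v∈ w with #-injective (trans (x∈⁅y⁆⇒x≡y i u∈) (sym (x∈⁅y⁆⇒x≡y i v∈)))
      ... | refl = here

    order∈dp : order ∈dp G
    order∈dp = >-nonZero⁻¹ order {{nonempty}} ,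
      subst (HasIsometricSubgraph G) (∣⊤∣≡n order)
        (fromSet conn (fromℕ< (>-nonZero⁻¹ order {{nonempty}}) , ∈⊤) ⊤-isometric)

    neighbourInGraph : 2 ≤ order → ∀ u → ∃[ w ] u ~ w
    neighbourInGraph 2≤order u = map₂ proj₁
      (neighbour conn ⊤-isometric (≤-trans 2≤order (≤-reflexive (sym (∣⊤∣≡n order)))) ∈⊤)

    2∈dp : 2 ≤ order → 2 ∈dp G
    2∈dp 2≤order = s≤s z≤n , subst (HasIsometricSubgraph G)
      (∣⁅x⁆∪⁅y⁆∣≡2 λ eq → ~-irrefl (#-injective eq) a~b) (fromSet conn (# a , a∈S) iso)
      where
      a = enum (fromℕ< (>-nonZero⁻¹ order {{nonempty}}))
      b = proj₁ (neighbourInGraph 2≤order a)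
      a~b = proj₂ (neighbourInGraph 2≤order a)
      S = ⁅ # a ⁆ ∪ ⁅ # b ⁆
      a∈S = p⊆p∪q ⁅ # b ⁆ (x∈⁅x⁆ (# a))
      b∈S = q⊆p∪q ⁅ # a ⁆ ⁅ # b ⁆ (x∈⁅x⁆ (# b))
      a-or-b : ∀ {v} → Member S v → v ≡ a ⊎ v ≡ b
      a-or-b v∈S with x∈p∪q⁻ ⁅ # a ⁆ ⁅ # b ⁆ v∈S
      ... | inj₁ v∈ = inj₁ (#-injective (x∈⁅y⁆⇒x≡y _ v∈))
      ... | inj₂ v∈ = inj₂ (#-injective (x∈⁅y⁆⇒x≡y _ v∈))
      iso : IsometricSet S
      iso _   _   here       = here
      iso u∈S v∈S (step r w) with a-or-b u∈S | a-or-b v∈S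
      ... | inj₁ refl | inj₁ refl = here
      ... | inj₁ refl | inj₂ refl = step (a~b , a∈S , b∈S) here
      ... | inj₂ refl | inj₁ refl = step (~-sym a~b , b∈S , a∈S) here
      ... | inj₂ refl | inj₂ refl = here

-- Isometric sets of a lexicographic product

module _ (G H : Graph) (connG : Connected G) where
  private
    module G = Graph G
    module H = Graph H
    module P = Graph (G [ H ]ₗ)

  module _ {T : Subset P.order} {S : Subset G.order} (proj : Projection T S) where

    project-∈ : ∀ {u x} → Member (G [ H ]ₗ) T (u , x) → Member G S u
    project-∈ {u} {x} ux∈T = Equivalence.from (proj (# G u)) (# H x , ux∈T)

    lift-∈ : ∀ {u} → Member G S u → ∃[ x ] Member (G [ H ]ₗ) T (u , x)
    lift-∈ {u} u∈S =
      let j , uj∈T = Equivalence.to (proj (# G u)) u∈S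
      in enum H j , subst (λ i → combine (# G u) i ∈ₛ T) (sym (#-enum H j)) uj∈T

    -- Lift the walk to the whole product with ends in `T`, replace it by an induced walk within the
    -- same bound, and project that one back.
    project-isometric : IsometricSet (G [ H ]ₗ) T → IsometricSet G S
    project-isometric iso {u} {v} u∈S v∈S w with u G.≟ v
    ... | yes refl = here
    ... | no u≢v   =
      let _ , ux∈T = lift-∈ u∈S
          _ , vy∈T = lift-∈ v∈S
      in mapWithin proj₁ edge (iso ux∈T vy∈T
           (lift {F = λ _ _ → Unit} (λ u~v _ _ → inj₁ u~v) (λ _ → anyH , tt) u≢v tt tt w))
      where
      anyH = enum H (fromℕ< (>-nonZero⁻¹ H.order {{H.nonempty}}))
      edge : ∀ {ux vy} → Induced (G [ H ]ₗ) T ux vy → Induced G S (proj₁ ux) (proj₁ vy) ⊎ proj₁ ux ≡ proj₁ vy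
      edge (inj₁ u~v       , ux∈T , vy∈T) = inj₁ (u~v , project-∈ ux∈T , project-∈ vy∈T)
      edge (inj₂ (_ , u≡v) , _    , _)    = inj₂ u≡v

    -- A single edge between members is induced. From bound 2 on, two points of one fibre are joined
    -- by a detour through a neighbour in `S`; for distinct fibres the walk is projected, made
    -- induced in `S`, and lifted through `T`.
    lift-isometric : 2 ≤ ∣ S ∣ → IsometricSet G S → IsometricSet (G [ H ]ₗ) T
    lift-isometric _ _ _ _ here = here
    lift-isometric _ _ ux∈T vy∈T (step r here) = step (r , ux∈T , vy∈T) here
    lift-isometric 2≤∣S∣ iso {u , x} {v , y} ux∈T vy∈T w@(step _ (step _ _)) with u G.≟ v
    ... | yes refl =
      let _ , u~w , u∈S , w∈S = neighbour G connG iso 2≤∣S∣ (project-∈ ux∈T)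
          _ , wz∈T = lift-∈ w∈S
      in step (inj₁ u~w , ux∈T , wz∈T) (step (inj₁ (G.~-sym u~w) , wz∈T , vy∈T) here)
    ... | no u≢v = lift (λ (u~v , _) ux∈T vy∈T → inj₁ u~v , ux∈T , vy∈T) (λ (_ , _ , v∈S) → lift-∈ v∈S)
      u≢v ux∈T vy∈T (iso (project-∈ ux∈T) (project-∈ vy∈T) (mapWithin proj₁ edge w))
      where
      edge : ∀ {ux vy} → ux P.~ vy → proj₁ ux G.~ proj₁ vy ⊎ proj₁ ux ≡ proj₁ vy
      edge (inj₁ u~v)       = inj₁ u~v
      edge (inj₂ (_ , u≡v)) = inj₂ u≡v

  -- Sizes of isometric subgraphs of the product, and the gap criterion

  module _ (2≤G : 2 ≤ G.order) where

    product-connected : Connected (G [ H ]ₗ)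
    product-connected (u , x) (v , y) with u G.≟ v
    ... | yes refl =
      let w , u~w = neighbourInGraph G connG 2≤G u
      in proj₁ (toPath {R = P._~_} P._≟_
           (step {d = 1} {w = w , x} (inj₁ u~w) (step {d = 0} (inj₁ (G.~-sym u~w)) here)))
    ... | no u≢v = proj₁ (toPath P._≟_
      (lift {Q = P._~_} {F = λ _ _ → Unit} (λ u~v _ _ → inj₁ u~v) (λ _ → x , tt) u≢v tt tt
        (fromWalk (proj₁ (connG u v)))))

    project-size : HasIsometricSubgraph (G [ H ]ₗ) e → ∃[ k ] (k ∈dp G × k ≤ e × e ≤ k * H.order)
    project-size sub with toSet (G [ H ]ₗ) sub
    ... | T , (t , t∈T) , iso , refl =
      let S , proj , lower , upper = project G.order H.order T
          nonempty = # G _ , project-∈ proj (subst (_∈ₛ T) (sym (#-enum (G [ H ]ₗ) t)) t∈T)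
      in ∣ S ∣ , (Nonempty⇒1≤∣p∣ nonempty , fromSet G connG nonempty (project-isometric proj iso)) , lower , upper

    -- The bound `2 ≤ k` feeds `lift-isometric`: a set inside a single fibre need not be isometric,
    -- since `H` may be disconnected.
    lift-size : k ∈dp G → 2 ≤ k → k ≤ e → e ≤ k * H.order → HasIsometricSubgraph (G [ H ]ₗ) e
    lift-size (_ , sub) 2≤k lower upper with toSet G sub
    ... | S , (i , i∈S) , iso , refl with spread {{H.nonempty}} S lower upper
    ...   | T , proj , refl =
      let j , ij∈T = Equivalence.to (proj i) i∈S
      in fromSet (G [ H ]ₗ) product-connected (_ , ij∈T) (lift-isometric proj 2≤k iso)

    dp⇒gap-bound : DistancePreserving (G [ H ]ₗ) →
      ∀ a b → BoundsNonDpInterval G a b → b ≤ a * H.order + 1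
    dp⇒gap-bound (_ , allSizes) a b gapped with b ≤? a * H.order + 1
    ... | yes b≤an+1 = b≤an+1
    ... | no b≰an+1 = contradiction (≤-trans c≤kn (*-monoˡ-≤ H.order k≤a)) (m+1+n≰m (a * H.order))
      where
      open BoundsNonDpInterval gapped
      instance _ = H.nonempty
      -- The first size out of reach for sets whose projection has at most `a` vertices. If `c < b`,
      -- the gap forces any projection of a set of size `c` to be that small.
      c = a * H.order + 1
      c<b : c < b
      c<b = ≰⇒> b≰an+1

      b≤order : b ≤ G.order
      b≤order with toSet G (proj₂ b∈dp)
      ... | S , _ , _ , refl = ∣p∣≤n S

      found : ∃[ k ] (k ∈dp G × k ≤ c × c ≤ k * H.order)
      found = project-size (allSizes c (m≤n+m 1 (a * H.order))
        (≤-trans (<⇒≤ c<b) (≤-trans b≤order (m≤m*n G.order H.order))))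
      k∈dp = proj₁ (proj₂ found)
      k≤c = proj₁ (proj₂ (proj₂ found))
      c≤kn = proj₂ (proj₂ (proj₂ found))

      k≤a : proj₁ found ≤ a
      k≤a = ≮⇒≥ λ a<k → gap _ a<k (≤-<-trans k≤c c<b) k∈dp

    gap-bound⇒dp : (∀ a b → BoundsNonDpInterval G a b → b ≤ a * H.order + 1) →
      DistancePreserving (G [ H ]ₗ)
    gap-bound⇒dp bound = product-connected , sizes
      where
      instance _ = H.nonempty

      sizes : ∀ i → 1 ≤ i → i ≤ P.order → HasIsometricSubgraph (G [ H ]ₗ) i
      -- Size 1 is treated apart, because lifting starts from two vertices.
      sizes 1 _ _ = proj₂ (1∈dp (G [ H ]ₗ) product-connected)
      sizes i@(suc (suc _)) _ i≤Gn with ∈dp? G connG i | G.order ≤? i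
      ... | yes i∈dp | _           = lift-size i∈dp (s≤s (s≤s z≤n)) ≤-refl (m≤m*n i H.order)
      -- All sizes from |G| on come from spreading over the whole vertex set.
      ... | no _     | yes order≤i = lift-size (order∈dp G connG) 2≤G order≤i i≤Gn
      -- Here `i` lies strictly between consecutive elements `a < b` of dp(G). The search for `a`
      -- starts from 2 rather than 1, so that `lift-size` applies to it; |G| caps the search for
      -- `b`.
      ... | no i∉dp  | no order≰i
        with greatestBelow (∈dp? G connG) (2∈dp G connG 2≤G)
               (≤∧≢⇒< (s≤s (s≤s z≤n)) λ 2≡i → i∉dp (subst (_∈dp G) 2≡i (2∈dp G connG 2≤G)))
           | least (λ b → (i <? b) ×-dec ∈dp? G connG b) (≰⇒> order≰i , order∈dp G connG)
      ... | a , 2≤a , a<i , a∈dp , a-maximal | b , (i<b , b∈dp) , b-minimal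
        with i ≤? a * H.order
      ...   | yes i≤an = lift-size a∈dp 2≤a (<⇒≤ a<i) i≤an
      ...   | no  i≰an = contradiction (<-≤-trans i<b (≤-trans (bound a b gapped) an+1≤i)) (n≮n i)
        where
        an+1≤i : a * H.order + 1 ≤ i
        an+1≤i = ≤-trans (≤-reflexive (+-comm (a * H.order) 1)) (≰⇒> i≰an)

        gap : ∀ c → a < c → c < b → ¬ (c ∈dp G)
        gap c a<c c<b c∈dp with <-cmp c i
        ... | tri< c<i _ _    = a-maximal a<c c<i c∈dp
        ... | tri≈ _ refl _   = i∉dp c∈dp
        ... | tri> _ _ i<c    = n≮n c (<-≤-trans c<b (b-minimal (i<c , c∈dp)))

        gapped : BoundsNonDpInterval G a b
        gapped = record
          { a∈dp = a∈dp ; b∈dp = b∈dp ; a<b = <-trans a<i i<b ; between = i , a<i , i<b ; gap = gap }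

theorem3p2 : (G H : Graph) (n : ℕ) → Connected G → Graph.order G ≥ 2 → Graph.order H ≡ n →
    DistancePreserving (G [ H ]ₗ) ⇔
    ((a b : ℕ) → BoundsNonDpInterval G a b → b ≤ a * n + 1)
theorem3p2 G H _ connG 2≤G refl = mk⇔ (dp⇒gap-bound G H connG 2≤G) (gap-bound⇒dp G H connG 2≤G)
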